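{- Let $q$ and $r$ be two positive integers and $u_0$ be a non-negative integer. Let $(u_n)_{n \in \mathbb{N}}$ be the sequence of natural numbers whose general term is $u_n = r [n]_q + u_0$. Suppose that $\gcd(u_0, r) = \gcd(u_1, q) = 1$. Then, for any positive integers $n$ and $k$ such that $n \geq k$, the positive integer $\mathrm{lcm}\{u_k, u_{k+1}, \dots, u_n\}$ is a multiple of the rational number $$\frac{u_k u_{k+1} \cdots u_n}{[n-k]_q!}.$$
   Context: $\mathbb{N}$ is the set of non-negative integers. For $n \in \mathbb{N}$, $[n]_q := \frac{q^n - 1}{q - 1}$ if $q \neq 1$ and $[n]_1 := n$; $[n]_q! := [n]_q [n-1]_q \cdots [1]_q$, with $[0]_q! := 1$. An integer $a$ is said to be a multiple of a non-zero rational number $\rho$ if $a/\rho$ is an integer. -}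

module Defs where

open import Data.Integer.Base as ℤ using (ℤ; +_)
open import Data.List.Base using (List; applyUpTo; foldr; map)
open import Data.List.Relation.Unary.All using (All; []; _∷_)
open import Data.List.Relation.Unary.All.Properties using (map⁺; applyUpTo⁺₂)
open import Data.Nat.Base
open import Data.Nat.DivMod using (_/_; m*n/n≡m; m≥n⇒m/n>0)
open import Data.Nat.LCM using (lcm)
open import Data.Nat.ListAction using (product)
open import Data.Nat.Properties
open import Data.Nat.Tactic.RingSolver using (solve-∀)
open import Data.Product using (∃-syntax; _,_)
open import Data.Rational.Base as ℚ using (ℚ; _÷_)
import Data.Rational.Properties as ℚₚ
open import Relation.Binary.PropositionalEquality

-- The q-integer [n]_q for q ≥ 1.  The natural-number quotient is exact,
-- see qInt-exact.
qInt : (q : ℕ) .{{_ : NonZero q}} → ℕ → ℕ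
qInt 1            n = n
qInt q@(2+ q-2) n = (q ^ n ∸ 1) / (q ∸ 1)

qFact : (q : ℕ) .{{_ : NonZero q}} → ℕ → ℕ
qFact q zero    = 1
qFact q (suc n) = qInt q (suc n) * qFact q n

term : (q r u₀ : ℕ) .{{_ : NonZero q}} → ℕ → ℕ
term q r u₀ n = r * qInt q n + u₀

-- k, k + 1, …, n  (empty if k > n).
[_⋯_] : ℕ → ℕ → List ℕ
[ k ⋯ n ] = applyUpTo (λ i → k + i) (suc n ∸ k)

lcms : List ℕ → ℕ
lcms = foldr lcm 1

infix 4 _IsMultipleOf_

_IsMultipleOf_ : ℤ → (ρ : ℚ) .{{_ : ℚ.NonZero ρ}} → Set
a IsMultipleOf ρ = ∃[ z ] (a ℚ./ 1) ÷ ρ ≡ z ℚ./ 1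

private
  geometric : ∀ q-2 n → ∃[ c ] 2+ q-2 ^ n ≡ suc (c * suc q-2)
  geometric q-2 zero    = 0 , refl
  geometric q-2 (suc n) with geometric q-2 n
  ... | c , eq = suc (2+ q-2 * c) , trans (cong (2+ q-2 *_) eq) (lemma q-2 c)
    where
    lemma : ∀ a c → (2 + a) * (1 + c * (1 + a)) ≡ 1 + (1 + (2 + a) * c) * (1 + a)
    lemma = solve-∀

qInt-exact : ∀ q .{{_ : NonZero q}} n → qInt q n * (q ∸ 1) ≡ q ^ n ∸ 1
qInt-exact 1 n = trans (*-zeroʳ n) (sym (cong (_∸ 1) (^-zeroˡ n)))
qInt-exact (2+ q-2) n with geometric q-2 n
... | c , eq rewrite eq = cong (_* suc q-2) (m*n/n≡m c (suc q-2))

term-zero : ∀ q r u₀ .{{_ : NonZero q}} → term q r u₀ 0 ≡ u₀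
term-zero 1        r u₀ = cong (_+ u₀) (*-zeroʳ r)
term-zero (2+ q-2) r u₀ = cong (_+ u₀) (*-zeroʳ r)

qInt≢0 : ∀ q n .{{_ : NonZero q}} .{{_ : NonZero n}} → NonZero (qInt q n)
qInt≢0 1 (suc n) = _
qInt≢0 q@(2+ q-2) (suc n) =
  >-nonZero (m≥n⇒m/n>0 (∸-monoˡ-≤ 1 (m≤m*n q (q ^ n) {{m^n≢0 q n}})))

term≢0 : ∀ q r u₀ n .{{_ : NonZero q}} .{{_ : NonZero r}} .{{_ : NonZero n}} →
         NonZero (term q r u₀ n)
term≢0 q r u₀ n = >-nonZero
  (≤-trans (>-nonZero⁻¹ (r * qInt q n)) (m≤m+n _ u₀))
  where
  instance
    _ = qInt≢0 q n
    _ = m*n≢0 r (qInt q n)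

product-nonZero : ∀ {ns} → All NonZero ns → NonZero (product ns)
product-nonZero []                   = _
product-nonZero (_∷_ {x} {xs} nz nzs) =
  m*n≢0 x (product xs) {{nz}} {{product-nonZero nzs}}

product-term≢0 : ∀ q r u₀ k n .{{_ : NonZero q}} .{{_ : NonZero r}} .{{_ : NonZero k}} →
                 NonZero (product (map (term q r u₀) [ k ⋯ n ]))
product-term≢0 q r u₀ k@(suc _) n = product-nonZero
  (map⁺ (applyUpTo⁺₂ (λ i → k + i) (suc n ∸ k) (λ i → term≢0 q r u₀ (k + i))))

qFact≢0 : ∀ q n .{{_ : NonZero q}} → NonZero (qFact q n)
qFact≢0 q zero    = _
qFact≢0 q (suc n) = m*n≢0 (qInt q (suc n)) (qFact q n) {{qInt≢0 q (suc n)}} {{qFact≢0 q n}}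

ratio≢0 : ∀ q r u₀ k n m .{{_ : NonZero q}} .{{_ : NonZero r}} .{{_ : NonZero k}} →
          ℚ.NonZero (ℚ._/_ (+ product (map (term q r u₀) [ k ⋯ n ]))
                           (qFact q m) {{qFact≢0 q m}})
ratio≢0 q r u₀ k n m = ℚₚ.pos⇒nonZero (+ P ℚ./ qFact q m)
  {{ℚₚ.normalize-pos P (qFact q m)}}
  where
  P = product (map (term q r u₀) [ k ⋯ n ])
  instance
    _ = qFact≢0 q m
    _ = product-term≢0 q r u₀ k n

{-# OPTIONS --safe #-}

-- Write u = term q r u₀ and let L be a common multiple of u_k, …, u_n.  By
-- induction on n - k, both u_k ⋯ u_{n-1} and u_{k+1} ⋯ u_n divide
-- L [n-k-1]_q!, so u_k ⋯ u_n divides both u_n L [n-k-1]_q! and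
-- u_k L [n-k-1]_q!.  Hence it divides their difference r q^k L [n-k]_q!,
-- where r q^k can be cancelled since it is coprime to every u_i with i ≥ 1.

module Submission where

open import Defs
open import Data.Integer.Base as ℤ using (+_)
import Data.Integer.Properties as ℤₚ
open import Data.List.Base using (map; applyUpTo; []; _∷_; [_]; _∷ʳ_)
open import Data.List.Properties using (map-applyUpTo; applyUpTo-∷ʳ)
open import Data.List.Relation.Unary.All as All using (All; []; _∷_)
open import Data.List.Relation.Unary.All.Properties using (applyUpTo⁻; applyUpTo⁺₂)
open import Data.Nat.Base
  using (ℕ; zero; suc; NonZero; 2+; _+_; _*_; _^_; _∸_; _≤_; _≥_; z≤n; s≤s)
open import Data.Nat.Coprimality as Coprimality
  using (Coprime; coprime-divisor; gcd≡1⇒coprime; 1-coprimeTo)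
open import Data.Nat.Divisibility
open import Data.Nat.GCD using (gcd)
open import Data.Nat.LCM using (m∣lcm[m,n]; n∣lcm[m,n])
open import Data.Nat.ListAction using (product)
open import Data.Nat.ListAction.Properties using (product-++)
open import Data.Nat.Properties
open import Data.Nat.Tactic.RingSolver using (solve-∀)
open import Data.Product.Base using (_,_)
open import Data.Rational.Base as ℚ using (_/_)
import Data.Rational.Properties as ℚₚ
import Data.Rational.Unnormalised.Base as ℚᵘ
import Data.Rational.Unnormalised.Properties as ℚᵘₚ
open import Function.Base using (_∘_)
open import Relation.Binary.PropositionalEquality
  using (_≡_; refl; sym; trans; cong; subst; module ≡-Reasoning)

coprime-* : ∀ {m n o} → Coprime m n → Coprime m o → Coprime m (n * o)
coprime-* c₁ c₂ (d∣m , d∣no) =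
  -- A common divisor d of m and n * o inherits coprimality to n from m, so it divides o.
  c₂ (d∣m , coprime-divisor (λ (e∣d , e∣n) → c₁ (∣-trans e∣d d∣m , e∣n)) d∣no)

coprime-^ : ∀ {m n} i → Coprime m n → Coprime m (n ^ i)
coprime-^ {m} zero    c = Coprimality.sym (1-coprimeTo m)
coprime-^     (suc i) c = coprime-* c (coprime-^ i c)

coprime-product : ∀ {m ns} → All (Coprime m) ns → Coprime m (product ns)
coprime-product {m} []       = Coprimality.sym (1-coprimeTo m)
coprime-product     (c ∷ cs) = coprime-* c (coprime-product cs)

coprime-linear : ∀ {a m} b → Coprime a m → Coprime (m * b + a) m
coprime-linear b c (d∣mb+a , d∣m) = c (∣m+n∣m⇒∣n d∣mb+a (∣m⇒∣m*n b d∣m) , d∣m)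

-- `applyUpTo` unfolds at the front; appending at the back exposes the last factor, which is what
-- dropping u_n in the induction requires.
product-applyUpTo-suc : ∀ (v : ℕ → ℕ) m →
                        product (applyUpTo v (suc m)) ≡ v m * product (applyUpTo v m)
product-applyUpTo-suc v m = begin
  product (applyUpTo v (suc m))         ≡⟨ cong product (applyUpTo-∷ʳ v m) ⟨
  product (applyUpTo v m ∷ʳ v m)        ≡⟨ product-++ (applyUpTo v m) [ v m ] ⟩
  product (applyUpTo v m) * (v m * 1)   ≡⟨ cong (product (applyUpTo v m) *_) (*-identityʳ (v m)) ⟩
  product (applyUpTo v m) * v m         ≡⟨ *-comm (product (applyUpTo v m)) (v m) ⟩
  v m * product (applyUpTo v m)         ∎
  where open ≡-Reasoning

∣-lcms : ∀ ns → All (_∣ lcms ns) ns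
∣-lcms []       = []
∣-lcms (n ∷ ns) =
  m∣lcm[m,n] n (lcms ns) ∷
  All.map (λ m∣ → ∣-trans m∣ (n∣lcm[m,n] n (lcms ns))) (∣-lcms ns)

-- Abstract sequences let the induction pass to `v ∘ suc` and `s ∘ suc` when the first factor is
-- dropped, and an arbitrary common multiple `L` serves both shorter ranges. In the application
-- `v i` is u_(k+i) and `s i` is r q^(k+i).
product∣commonMultiple*qFact :
  ∀ q .{{_ : NonZero q}} (v s : ℕ → ℕ) →
  (∀ i d → v (i + d) ≡ v i + s i * qInt q d) →
  (∀ i j → Coprime (s i) (v j)) →
  ∀ m {L} → (∀ {i} → i ≤ m → v i ∣ L) →
  product (applyUpTo v (suc m)) ∣ L * qFact q m
product∣commonMultiple*qFact q v s shift cop zero    v∣L = *-monoˡ-∣ 1 (v∣L z≤n)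
product∣commonMultiple*qFact q v s shift cop (suc m) {L} v∣L =
  -- Divisibility of a sum and of its first summand gives that of the second, which replaces the
  -- subtraction; then `s 0` is cancelled.
  coprime-divisor (Coprimality.sym cop₀)
    (∣m+n∣m⇒∣n (subst (P ∣_) split P∣last) P∣first)
  where
  open ≡-Reasoning
  P = product (applyUpTo v (2+ m))
  M = L * qFact q m

  cop₀ : Coprime (s 0) P
  cop₀ = coprime-product (applyUpTo⁺₂ v (2+ m) (cop 0))

  P∣first : P ∣ v 0 * M
  P∣first = *-monoʳ-∣ (v 0)
    (product∣commonMultiple*qFact q (v ∘ suc) (s ∘ suc)
      (λ i → shift (suc i)) (λ i j → cop (suc i) (suc j)) m (λ i≤m → v∣L (s≤s i≤m)))

  P∣last : P ∣ v (suc m) * M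
  P∣last = subst (_∣ v (suc m) * M) (sym (product-applyUpTo-suc v (suc m)))
    (*-monoʳ-∣ (v (suc m))
      (product∣commonMultiple*qFact q v s shift cop m (λ i≤m → v∣L (m≤n⇒m≤1+n i≤m))))

  distribute : ∀ a s w L f → (a + s * w) * (L * f) ≡ a * (L * f) + s * (L * (w * f))
  distribute = solve-∀

  -- The factor `qInt q (suc m)` produced by `shift` merges with `qFact q m` into `qFact q (suc m)`
  -- by definition.
  split : v (suc m) * M ≡ v 0 * M + s 0 * (L * qFact q (suc m))
  split = begin
    v (suc m) * M                           ≡⟨ cong (_* M) (shift 0 (suc m)) ⟩
    (v 0 + s 0 * qInt q (suc m)) * M        ≡⟨ distribute (v 0) (s 0) (qInt q (suc m)) L (qFact q m) ⟩
    v 0 * M + s 0 * (L * qFact q (suc m))   ∎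

-- For q ≥ 2, multiplying [i]_q by q - 1 and adding 1 gives q^i, so the identity reduces to q^(m+n)
-- = q^m q^n. The added 1 keeps truncated subtraction out of the computation.
qInt-+ : ∀ q .{{_ : NonZero q}} m n → qInt q (m + n) ≡ qInt q m + q ^ m * qInt q n
qInt-+ 1 m n = cong (λ x → m + x) (sym (trans (cong (_* n) (^-zeroˡ m)) (*-identityˡ n)))
qInt-+ q@(2+ q-2) m n = *-cancelʳ-≡ _ _ (suc q-2) (suc-injective (begin
  1 + qInt q (m + n) * p                          ≡⟨ exact (m + n) ⟩
  q ^ (m + n)                                     ≡⟨ ^-distribˡ-+-* q m n ⟩
  q ^ m * q ^ n                                   ≡⟨ cong (q ^ m *_) (exact n) ⟨
  q ^ m * (1 + qInt q n * p)                      ≡⟨ expand (q ^ m) (qInt q n) p ⟩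
  q ^ m + q ^ m * qInt q n * p                    ≡⟨ cong (_+ q ^ m * qInt q n * p) (exact m) ⟨
  1 + qInt q m * p + q ^ m * qInt q n * p         ≡⟨ collect (qInt q m) (q ^ m * qInt q n) p ⟩
  1 + (qInt q m + q ^ m * qInt q n) * p           ∎))
  where
  open ≡-Reasoning
  p = suc q-2

  exact : ∀ i → 1 + qInt q i * p ≡ q ^ i
  exact i = trans (cong suc (qInt-exact q i)) (m+[n∸m]≡n (m^n>0 q i))

  expand : ∀ x b p → x * (1 + b * p) ≡ x + x * b * p
  expand = solve-∀

  collect : ∀ a y p → 1 + a * p + y * p ≡ 1 + (a + y) * p
  collect = solve-∀

module _ (q r u₀ : ℕ) .{{_ : NonZero q}} where

  term-+ : ∀ i d → term q r u₀ (i + d) ≡ term q r u₀ i + r * q ^ i * qInt q d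
  term-+ i d = trans (cong (λ x → r * x + u₀) (qInt-+ q i d))
                     (rearrange r (qInt q i) (q ^ i) (qInt q d) u₀)
    where
    rearrange : ∀ r a x b u → r * (a + x * b) + u ≡ r * a + u + r * x * b
    rearrange = solve-∀

  -- Modulo r every term is congruent to u₀.
  coprime-term-ratio : Coprime u₀ r → ∀ n → Coprime (term q r u₀ n) r
  coprime-term-ratio c n = coprime-linear (qInt q n) c

  -- Modulo q every term of positive index is congruent to u₁, because [n+1]_q = 1 + q [n]_q.
  coprime-term-base : Coprime (term q r u₀ 1) q → ∀ n → Coprime (term q r u₀ (suc n)) q
  coprime-term-base c n = subst (λ x → Coprime x q) (sym eq) (coprime-linear (r * qInt q n) c)
    where
    -- The factor q * 1 is `q ^ 1` unfolded.
    rearrange : ∀ u r q b → u + r * (q * 1) * b ≡ q * (r * b) + u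
    rearrange = solve-∀

    eq : term q r u₀ (suc n) ≡ q * (r * qInt q n) + term q r u₀ 1
    eq = trans (term-+ 1 n) (rearrange (term q r u₀ 1) r q (qInt q n))

  product-term∣lcms*qFact :
    Coprime u₀ r → Coprime (term q r u₀ 1) q →
    ∀ n k .{{_ : NonZero k}} → n ≥ k →
    product (map (term q r u₀) [ k ⋯ n ]) ∣ lcms (map (term q r u₀) [ k ⋯ n ]) * qFact q (n ∸ k)
  product-term∣lcms*qFact cr cq n k@(suc k-1) n≥k =
    subst (λ ns → product ns ∣ lcms ns * qFact q m) (sym terms)
      -- The common multiple `L` is taken to be the least one.
      (product∣commonMultiple*qFact q v s shift cop m
        (λ i≤m → applyUpTo⁻ v (suc m) (∣-lcms (applyUpTo v (suc m))) (s≤s i≤m)))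
    where
    m = n ∸ k
    v s : ℕ → ℕ
    v i = term q r u₀ (k + i)
    s i = r * q ^ (k + i)

    terms : map (term q r u₀) [ k ⋯ n ] ≡ applyUpTo v (suc m)
    terms = trans (map-applyUpTo (λ i → k + i) (term q r u₀) (suc n ∸ k))
                  -- Here n ≥ k is essential: it turns `suc n ∸ k` into `suc (n ∸ k)` despite
                  -- truncation.
                  (cong (applyUpTo v) (+-∸-assoc 1 n≥k))

    shift : ∀ i d → v (i + d) ≡ v i + s i * qInt q d
    shift i d = trans (cong (term q r u₀) (sym (+-assoc k i d))) (term-+ (k + i) d)

    cop : ∀ i j → Coprime (s i) (v j)
    cop i j = Coprimality.sym
      (coprime-* (coprime-term-ratio cr (k + j))
                 -- Since k is a successor, the index k + j is positive, as coprimality to q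
                 -- demands.
                 (coprime-^ (k + i) (coprime-term-base cq (k-1 + j))))

-- The quotient of a by b/c is ac/b, so the witness z is the cofactor of b in a * c.
∣*⇒IsMultipleOf : ∀ a b c .{{_ : NonZero c}} .{{ρ≢0 : ℚ.NonZero (+ b / c)}} →
                  b ∣ a * c → (+ a) IsMultipleOf (+ b / c)
∣*⇒IsMultipleOf a b c@(suc c-1) {{ρ≢0}} (divides z ac≡zb) = + z , (begin
  (+ a / 1) ℚ.* ℚ.1/ ρ              ≡⟨ cong (ℚ._* ℚ.1/ ρ) a≡zρ ⟩
  (+ z / 1) ℚ.* ρ ℚ.* ℚ.1/ ρ        ≡⟨ ℚₚ.*-assoc (+ z / 1) ρ (ℚ.1/ ρ) ⟩
  (+ z / 1) ℚ.* (ρ ℚ.* ℚ.1/ ρ)      ≡⟨ cong ((+ z / 1) ℚ.*_) (ℚₚ.*-inverseʳ ρ) ⟩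
  (+ z / 1) ℚ.* ℚ.1ℚ                ≡⟨ ℚₚ.*-identityʳ (+ z / 1) ⟩
  + z / 1                           ∎)
  where
  open ≡-Reasoning
  ρ = + b / c

  -- Cross-multiplied form of a/1 = (z/1)(b/c), where the right side has denominator 1 * c.
  cross : + a ℤ.* + (1 * c) ≡ (+ z ℤ.* + b) ℤ.* + 1
  cross = begin
    + a ℤ.* + (1 * c)         ≡⟨ cong (λ x → + a ℤ.* + x) (*-identityˡ c) ⟩
    + a ℤ.* + c               ≡⟨ ℤₚ.pos-* a c ⟨
    + (a * c)                 ≡⟨ cong +_ ac≡zb ⟩
    + (z * b)                 ≡⟨ ℤₚ.pos-* z b ⟩
    + z ℤ.* + b               ≡⟨ ℤₚ.*-identityʳ (+ z ℤ.* + b) ⟨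
    (+ z ℤ.* + b) ℤ.* + 1     ∎

  -- The fractions in `ℚ` are normalised, so equality is checked on unnormalised representatives.
  -- `mkℚᵘ` takes the denominator minus one, whence 0 and `c-1`.
  a≡zρ : + a / 1 ≡ (+ z / 1) ℚ.* ρ
  a≡zρ = ℚₚ.toℚᵘ-injective (≃R.begin
    ℚ.toℚᵘ (+ a / 1)                        ≃R.≈⟨ ℚₚ.toℚᵘ-fromℚᵘ (ℚᵘ.mkℚᵘ (+ a) 0) ⟩
    ℚᵘ.mkℚᵘ (+ a) 0                         ≃R.≈⟨ ℚᵘ.*≡* cross ⟩
    ℚᵘ.mkℚᵘ (+ z) 0 ℚᵘ.* ℚᵘ.mkℚᵘ (+ b) c-1  ≃R.≈⟨ ℚᵘₚ.*-cong (ℚₚ.toℚᵘ-fromℚᵘ (ℚᵘ.mkℚᵘ (+ z) 0))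
                                                            (ℚₚ.toℚᵘ-fromℚᵘ (ℚᵘ.mkℚᵘ (+ b) c-1)) ⟨
    ℚ.toℚᵘ (+ z / 1) ℚᵘ.* ℚ.toℚᵘ ρ          ≃R.≈⟨ ℚₚ.toℚᵘ-homo-* (+ z / 1) ρ ⟨
    ℚ.toℚᵘ ((+ z / 1) ℚ.* ρ)                ≃R.∎)
    where
    import Relation.Binary.Reasoning.Setoid ℚᵘₚ.≃-setoid as ≃R

theorem1p1 : (q r u₀ : ℕ) .{{_ : NonZero q}} .{{_ : NonZero r}} →
    let u = term q r u₀ in
    gcd u₀ r ≡ 1 → gcd (u 1) q ≡ 1 →
    (n k : ℕ) .{{_ : NonZero n}} .{{_ : NonZero k}} → n ≥ k →
    let ρ = _/_ (+ product (map u [ k ⋯ n ])) (qFact q (n ∸ k)) {{qFact≢0 q (n ∸ k)}} in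
    _IsMultipleOf_ (+ lcms (map u [ k ⋯ n ])) ρ {{ratio≢0 q r u₀ k n (n ∸ k)}}
theorem1p1 q r u₀ gcd-u₀-r gcd-u₁-q n k n≥k =
  ∣*⇒IsMultipleOf (lcms us) (product us) (qFact q (n ∸ k))
    {{qFact≢0 q (n ∸ k)}} {{ratio≢0 q r u₀ k n (n ∸ k)}}
    (product-term∣lcms*qFact q r u₀ (gcd≡1⇒coprime gcd-u₀-r) (gcd≡1⇒coprime gcd-u₁-q) n k n≥k)
  where us = map (term q r u₀) [ k ⋯ n ]
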